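{- Let $L,T$ be finite distributive lattices and $p:L\to T$ a map such that (i) $p|_{\mathcal{J}(L)}$ is a quotient map, (ii) $p(\mathcal{J}(L))=\mathcal{J}(T)$, and (iii) $p$ is a join-preserving quotient map of posets. Let $p_0=p|_{\mathcal{J}(L)}:\mathcal{J}(L)\to\mathcal{J}(T)$. Then $\mathbf{B}_T\circ p=\hat{p_0}\circ\mathbf{B}_L$, where $\mathbf{B}_L:L\to\mathcal{O}(\mathcal{J}(L))$, $\mathbf{B}_L(a)=\{x\in\mathcal{J}(L):x\le a\}$ and $\mathbf{B}_T$ analogously are the Birkhoff isomorphisms; in particular $p$ is isomorphic to the induced map $\hat{p_0}$.
   Context: $\mathcal{J}(L)$ is the set of join-irreducible elements of $L$ (elements $x\ne0$ such that $x=a\vee b$ implies $x=a$ or $x=b$), with the order inherited from $L$. A quotient map between posets is a surjective order-preserving map $\phi:A\to B$ such that for all $a\le b$ in $B$ there are $x\le y$ in $A$ with $\phi(x)=a,\phi(y)=b$. $\mathcal{O}(Q)$ denotes the down-sets of a poset $Q$ under inclusion, $\downarrow x=\{m:m\le x\}$; for a quotient map $p_0:Q\to R$ of finite posets, $\hat{p_0}(\emptyset)=\emptyset$ and $\hat{p_0}(A)=\bigcup_i\downarrow p_0(a_i)$ over the maximal elements $a_i$ of $A$. Two maps $f:A\to B$, $f':A'\to B'$ are isomorphic if there are isomorphisms $g_1:A\to A'$, $g_2:B\to B'$ with $g_2\circ f=f'\circ g_1$. -}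

module Defs where

open import Level using (Level; _⊔_; suc)
open import Data.Bool.Base using (Bool; T)
open import Data.List.Base using (List; []; _∷_)
open import Data.List.Relation.Unary.All as All using (All)
open import Data.List.Relation.Unary.Any as Any using (Any; here; there)
open import Data.List.Relation.Unary.Enumerates.Setoid using (IsEnumeration)
import Data.List.Membership.Setoid as Membership
open import Data.Product.Base using (Σ; ∃; ∃-syntax; _×_; _,_; proj₁; proj₂)
open import Data.Sum.Base using (_⊎_; inj₁; inj₂)
open import Relation.Binary.Bundles using (Setoid; Poset; DecPoset)
open import Relation.Binary.Definitions using (Minimum; _Respects_)
  renaming (Decidable to Decidable₂)
open import Relation.Binary.Lattice.Bundles using (DistributiveLattice)
open import Relation.Binary.Morphism.Structures
  using (IsOrderHomomorphism; IsOrderIsomorphism)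
import Relation.Binary.Construct.On as On
open import Relation.Nullary using (¬_; Dec; yes; no; ⌊_⌋)
open import Relation.Nullary.Decidable
  using (map′; toWitness; fromWitness; _×-dec_; _⊎-dec_; _→-dec_; ¬?; T?)
open import Relation.Unary using (Pred; Decidable; _≐_)
open import Function.Definitions using (Surjective)

private
  variable
    a c c′ d d′ ℓ ℓ′ ℓ₁ ℓ₂ ℓ₃ ℓ₄ ℓ₅ ℓ₆ ℓ₇ ℓ₈ : Level

module _ (S : Setoid a ℓ) {xs : List (Setoid.Carrier S)}
         (enum : IsEnumeration S xs) where
  open Setoid S
  open Membership S using (lose; _∈_)

  ∃? : {P : Pred Carrier ℓ′} → P Respects _≈_ → Decidable P → Dec (∃ P)
  ∃? resp P? = map′ Any.satisfied (λ (x , px) → lose resp (enum x) px)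
                    (Any.any? P? xs)

  ∀? : {P : Pred Carrier ℓ′} → P Respects _≈_ → Decidable P → Dec (∀ x → P x)
  ∀? {P = P} resp P? =
    map′ (λ ps x → lookup ps (enum x)) (λ f → All.universal f xs) (All.all? P? xs)
    where
    lookup : ∀ {ys x} → All P ys → x ∈ ys → P x
    lookup ps x∈ys =
      let py , x≈y = All.lookupAny ps x∈ys in resp (sym x≈y) py

-- A list of all elements (repetitions allowed) together with decidability
-- of ≈ and ≤, which is automatic classically, is the constructive notion
-- of a finite poset.
record FinitePoset c ℓ₁ ℓ₂ : Set (suc (c ⊔ ℓ₁ ⊔ ℓ₂)) where
  field
    decPoset : DecPoset c ℓ₁ ℓ₂
  open DecPoset decPoset public
  field
    elements   : List Carrier
    enumerates : IsEnumeration Eq.setoid elements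

record IsQuotientMap (A : Poset c ℓ₁ ℓ₂) (B : Poset d ℓ₃ ℓ₄)
                     (φ : Poset.Carrier A → Poset.Carrier B)
                     : Set (c ⊔ ℓ₁ ⊔ ℓ₂ ⊔ d ⊔ ℓ₃ ⊔ ℓ₄) where
  private
    module A = Poset A
    module B = Poset B
  field
    isOrderHomomorphism : IsOrderHomomorphism A._≈_ B._≈_ A._≤_ B._≤_ φ
    surjective          : Surjective A._≈_ B._≈_ φ
    lift                : ∀ {a b} → a B.≤ b →
                          ∃[ x ] ∃[ y ] x A.≤ y × φ x B.≈ a × φ y B.≈ b
  open IsOrderHomomorphism isOrderHomomorphism public using (cong; mono)

PosetIsomorphism : (A : Poset c ℓ₁ ℓ₂) (B : Poset d ℓ₃ ℓ₄) → Set _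
PosetIsomorphism A B =
  ∃ (IsOrderIsomorphism (Poset._≈_ A) (Poset._≈_ B) (Poset._≤_ A) (Poset._≤_ B))

IsomorphicMaps : (A : Poset c ℓ₁ ℓ₂) (B : Poset d ℓ₃ ℓ₄)
                 (A′ : Poset c′ ℓ₅ ℓ₆) (B′ : Poset d′ ℓ₇ ℓ₈) →
                 (Poset.Carrier A → Poset.Carrier B) →
                 (Poset.Carrier A′ → Poset.Carrier B′) → Set _
IsomorphicMaps A B A′ B′ f f′ =
  Σ (PosetIsomorphism A A′) λ (g₁ , _) →
  Σ (PosetIsomorphism B B′) λ (g₂ , _) →
  ∀ x → Poset._≈_ B′ (g₂ (f x)) (f′ (g₁ x))

-- Subsets are given by characteristic functions: subsets of a finite poset
-- are decidable classically, whereas constructively arbitrary predicates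
-- would not form a finite lattice. A subset respects ≈ because it is
-- down-closed.
record DownSet (Q : FinitePoset c ℓ₁ ℓ₂) : Set (c ⊔ ℓ₂) where
  open FinitePoset Q
  field
    member     : Carrier → Bool
    downClosed : ∀ {x y} → y ≤ x → T (member x) → T (member y)

infix 4 _∈_
_∈_ : {Q : FinitePoset c ℓ₁ ℓ₂} → FinitePoset.Carrier Q → DownSet Q → Set
x ∈ A = T (DownSet.member A x)

𝓞 : FinitePoset c ℓ₁ ℓ₂ → Poset (c ⊔ ℓ₂) c c
𝓞 Q = record
  { Carrier = DownSet Q
  ; _≈_     = λ A B → A ⊆ B × B ⊆ A
  ; _≤_     = _⊆_
  ; isPartialOrder = record
    { isPreorder = record
      { isEquivalence = record
        { refl  = (λ _ m → m) , (λ _ m → m)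
        ; sym   = λ (p , q) → q , p
        ; trans = λ (p , q) (r , s) →
            (λ x m → r x (p x m)) , (λ x m → q x (s x m))
        }
      ; reflexive = proj₁
      ; trans     = λ p q x m → q x (p x m)
      }
    ; antisym = _,_
    }
  }
  where
  _⊆_ : DownSet Q → DownSet Q → Set _
  A ⊆ B = ∀ x → x ∈ A → x ∈ B

module _ (Q : FinitePoset c ℓ₁ ℓ₂) where
  open FinitePoset Q

  decDownSet : {P : Pred Carrier ℓ} → Decidable P →
               (∀ {x y} → y ≤ x → P x → P y) → DownSet Q
  decDownSet P? closed = record
    { member     = λ x → ⌊ P? x ⌋
    ; downClosed = λ {x} {y} y≤x m →
        fromWitness {a? = P? y} (closed y≤x (toWitness {a? = P? x} m))
    }

  IsMaximal : DownSet Q → Carrier → Set (c ⊔ ℓ₁ ⊔ ℓ₂)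
  IsMaximal A a = a ∈ A × (∀ b → b ∈ A → a ≤ b → a ≈ b)

  private
    ∈-resp : (A : DownSet Q) → (_∈ A) Respects _≈_
    ∈-resp A x≈y = DownSet.downClosed A (reflexive (Eq.sym x≈y))

  isMaximal-resp : (A : DownSet Q) → IsMaximal A Respects _≈_
  isMaximal-resp A x≈y (x∈A , max) = ∈-resp A x≈y x∈A , λ b b∈A y≤b →
    Eq.trans (Eq.sym x≈y) (max b b∈A (trans (reflexive x≈y) y≤b))

  isMaximal? : (A : DownSet Q) → Decidable (IsMaximal A)
  isMaximal? A a = T? _ ×-dec
    ∀? Eq.setoid enumerates
      (λ x≈y f y∈A a≤y →
        Eq.trans (f (∈-resp A (Eq.sym x≈y) y∈A)
                    (trans a≤y (reflexive (Eq.sym x≈y)))) x≈y)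
      (λ b → T? _ →-dec ((a ≤? b) →-dec (a ≟ b)))

-- hat φ A is the union of the sets ↓ φ a over the maximal elements a of A;
-- in particular hat φ ∅ = ∅.
module _ (Q : FinitePoset c ℓ₁ ℓ₂) (R : FinitePoset d ℓ₃ ℓ₄) where
  private
    module Q = FinitePoset Q
    module R = FinitePoset R

  hat : {φ : Q.Carrier → R.Carrier} → IsQuotientMap Q.poset R.poset φ →
        DownSet Q → DownSet R
  hat {φ} φ-quot A = decDownSet R
    {P = λ r → ∃[ a ] IsMaximal Q A a × r R.≤ φ a}
    (λ r → ∃? Q.Eq.setoid Q.enumerates
      (λ x≈y (max , r≤φx) → isMaximal-resp Q A x≈y max ,
        R.trans r≤φx (R.reflexive (IsQuotientMap.cong φ-quot x≈y)))
      (λ a → isMaximal? Q A a ×-dec (r R.≤? φ a)))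
    (λ s≤r (a , max , r≤φa) → a , max , R.trans s≤r r≤φa)

-- Every nonempty finite lattice has a least element; it is a field so that
-- the empty lattice is excluded. Maps are not assumed to preserve it.
record FiniteDistributiveLattice c ℓ₁ ℓ₂ : Set (suc (c ⊔ ℓ₁ ⊔ ℓ₂)) where
  field
    distributiveLattice : DistributiveLattice c ℓ₁ ℓ₂
  open DistributiveLattice distributiveLattice public
  field
    ⊥          : Carrier
    minimum    : Minimum _≤_ ⊥
    _≟_        : Decidable₂ _≈_
    elements   : List Carrier
    enumerates : IsEnumeration setoid elements

  _≤?_ : Decidable₂ _≤_
  x ≤? y = map′
    (λ x≈x∧y → trans (reflexive x≈x∧y) (x∧y≤y x y))
    (λ x≤y → antisym (∧-greatest refl x≤y) (x∧y≤x x y))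
    (x ≟ (x ∧ y))

  JoinIrreducible : Pred Carrier (c ⊔ ℓ₁)
  JoinIrreducible x = ¬ x ≈ ⊥ × (∀ a b → x ≈ a ∨ b → x ≈ a ⊎ x ≈ b)

  private
    ∨-mono : ∀ {x y x′ y′} → x ≤ x′ → y ≤ y′ → x ∨ y ≤ x′ ∨ y′
    ∨-mono x≤x′ y≤y′ = ∨-least (trans x≤x′ (x≤x∨y _ _)) (trans y≤y′ (y≤x∨y _ _))

    ∨-cong : ∀ {x y x′ y′} → x ≈ x′ → y ≈ y′ → x ∨ y ≈ x′ ∨ y′
    ∨-cong p q = antisym (∨-mono (reflexive p) (reflexive q))
      (∨-mono (reflexive (Eq.sym p)) (reflexive (Eq.sym q)))

    ⊎-resp : ∀ {x a b a′ b′} → a ≈ a′ → b ≈ b′ →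
             (x ≈ a ∨ b → x ≈ a ⊎ x ≈ b) → (x ≈ a′ ∨ b′ → x ≈ a′ ⊎ x ≈ b′)
    ⊎-resp p q f e with f (Eq.trans e (∨-cong (Eq.sym p) (Eq.sym q)))
    ... | inj₁ x≈a = inj₁ (Eq.trans x≈a p)
    ... | inj₂ x≈b = inj₂ (Eq.trans x≈b q)

  joinIrreducible-resp : JoinIrreducible Respects _≈_
  joinIrreducible-resp {x} {y} x≈y (x≉⊥ , irr) =
    (λ y≈⊥ → x≉⊥ (Eq.trans x≈y y≈⊥)) , split
    where
    split : ∀ a b → y ≈ a ∨ b → y ≈ a ⊎ y ≈ b
    split a b e with irr a b (Eq.trans x≈y e)
    ... | inj₁ x≈a = inj₁ (Eq.trans (Eq.sym x≈y) x≈a)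
    ... | inj₂ x≈b = inj₂ (Eq.trans (Eq.sym x≈y) x≈b)

  joinIrreducible? : Decidable JoinIrreducible
  joinIrreducible? x = ¬? (x ≟ ⊥) ×-dec
    ∀? setoid enumerates (λ a≈a′ f b → ⊎-resp a≈a′ Eq.refl (f b)) (λ a →
      ∀? setoid enumerates (λ b≈b′ → ⊎-resp Eq.refl b≈b′) (λ b →
        (x ≟ (a ∨ b)) →-dec ((x ≟ a) ⊎-dec (x ≟ b))))

module _ (L : FiniteDistributiveLattice c ℓ₁ ℓ₂) where
  open FiniteDistributiveLattice L

  private
    keep : List Carrier → List (Σ Carrier JoinIrreducible)
    keep []       = []
    keep (x ∷ xs) with joinIrreducible? x
    ... | yes jx = (x , jx) ∷ keep xs
    ... | no  _  = keep xs

    keep-complete : ∀ {x} → JoinIrreducible x → ∀ {xs} → Any (x ≈_) xs →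
                    Any (λ j → x ≈ proj₁ j) (keep xs)
    keep-complete jx {y ∷ xs} x∈ with joinIrreducible? y | x∈
    ... | yes _  | here x≈y  = here x≈y
    ... | yes _  | there x∈′ = there (keep-complete jx x∈′)
    ... | no ¬jy | here x≈y  with () ← ¬jy (joinIrreducible-resp x≈y jx)
    ... | no _   | there x∈′ = keep-complete jx x∈′

  𝓙 : FinitePoset (c ⊔ ℓ₁) ℓ₁ ℓ₂
  𝓙 = record
    { decPoset = On.decPoset
        (record { isDecPartialOrder = record
          { isPartialOrder = isPartialOrder ; _≟_ = _≟_ ; _≤?_ = _≤?_ } })
        (proj₁ {B = JoinIrreducible})
    ; elements   = keep elements
    ; enumerates = λ (x , jx) → keep-complete jx (enumerates x)
    }

  birkhoff : Carrier → DownSet 𝓙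
  birkhoff a = decDownSet 𝓙 {P = λ (x , _) → x ≤ a} (λ (x , _) → x ≤? a) trans

module _ (L : FiniteDistributiveLattice c ℓ₁ ℓ₂)
         (M : FiniteDistributiveLattice d ℓ₃ ℓ₄) where
  private
    module L = FiniteDistributiveLattice L
    module M = FiniteDistributiveLattice M

  PreservesJoins : (L.Carrier → M.Carrier) → Set (c ⊔ ℓ₃)
  PreservesJoins p = ∀ x y → p (x L.∨ y) M.≈ p x M.∨ p y

  𝓙ImageIs𝓙 : (L.Carrier → M.Carrier) → Set (c ⊔ ℓ₁ ⊔ d ⊔ ℓ₃)
  𝓙ImageIs𝓙 p =
    (λ y → ∃[ x ] L.JoinIrreducible x × p x M.≈ y) ≐ M.JoinIrreducible

  restrict𝓙 : (p : L.Carrier → M.Carrier) → 𝓙ImageIs𝓙 p →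
              FinitePoset.Carrier (𝓙 L) → FinitePoset.Carrier (𝓙 M)
  restrict𝓙 p (image⊆ , _) (x , jx) = p x , image⊆ (x , jx , M.Eq.refl)

{-# OPTIONS --safe #-}

-- Every element of a finite lattice is a join of join-irreducibles, and in a
-- distributive lattice a join-irreducible below x ∨ y is below x or below y.
-- Since p is surjective and monotone, p ⊥ ≈ ⊥, so p preserves all finite joins
-- and a join-irreducible lies below p a exactly when it lies below p x for some
-- join-irreducible x ≤ a. By finiteness such an x can be taken maximal, which
-- is membership in the hat construction applied to birkhoff L a.
module Submission where

open import Defs
open import Data.Empty using (⊥-elim)
open import Data.Fin.Base using (Fin)
open import Data.Fin.Induction using (po-wellFounded; po-noetherian)
open import Data.List.Base using (List; []; _∷_; length; lookup)
open import Data.List.Relation.Unary.Any as Any using (Any; here; there)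
open import Data.List.Relation.Unary.Any.Properties using (lookup-index)
open import Data.Product.Base using (∃-syntax; _×_; _,_; proj₁; proj₂)
open import Data.Sum.Base as Sum using (_⊎_; inj₁; inj₂)
open import Function.Base using (_∘_; flip)
open import Induction.WellFounded using (Acc; acc; WellFounded; module Subrelation)
open import Level using (Level)
open import Relation.Binary.Bundles using (Poset)
import Relation.Binary.Construct.NonStrictToStrict as ToStrict
import Relation.Binary.Construct.On as On
import Relation.Binary.Lattice.Properties.JoinSemilattice as JoinSemilatticeProperties
open import Relation.Binary.Morphism.Structures using (IsOrderIsomorphism)
open import Relation.Binary.Definitions using (_Respects_)
open import Relation.Binary.Structures using (IsPartialOrder)
open import Relation.Nullary using (¬_; Dec; yes; no)
open import Relation.Nullary.Decidable
  using (toWitness; fromWitness; _×-dec_; ¬?; T?)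
open import Relation.Unary using (Pred)

private
  variable
    c d ℓ ℓ₁ ℓ₂ ℓ₃ ℓ₄ : Level

-- Finite posets: well-foundedness and maximal elements.

module FinitePosetProperties (Q : FinitePoset c ℓ₁ ℓ₂) where
  open FinitePoset Q
  open ToStrict _≈_ _≤_ public using (_<_)

  private
    elementAt : Fin (length elements) → Carrier
    elementAt = lookup elements

    index : Carrier → Fin (length elements)
    index x = Any.index (enumerates x)

    elementAt-index : ∀ x → x ≈ elementAt (index x)
    elementAt-index x = lookup-index (enumerates x)

    isPartialOrder-on-index : IsPartialOrder _ _
    isPartialOrder-on-index = On.isPartialOrder elementAt isPartialOrder

    -- Equal elements may receive different indices, since the list can repeat; that `x` equals the
    -- entry at `index x` is enough to carry strict inequalities over to `Fin`, where
    -- well-foundedness is known.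
    index-mono-< : ∀ {x y} → x < y → elementAt (index x) < elementAt (index y)
    index-mono-< {x} {y} = ToStrict.<-respˡ-≈ _≈_ _≤_ Eq.trans ≤-respˡ-≈ (elementAt-index x)
      ∘ ToStrict.<-respʳ-≈ _≈_ _≤_ Eq.sym Eq.trans ≤-respʳ-≈ (elementAt-index y)

  <-wellFounded : WellFounded _<_
  <-wellFounded = Subrelation.wellFounded index-mono-<
    (On.wellFounded index (po-wellFounded isPartialOrder-on-index))

  >-wellFounded : WellFounded (flip _<_)
  >-wellFounded = Subrelation.wellFounded index-mono-<
    (On.wellFounded index (po-noetherian isPartialOrder-on-index))

  -- Climb from `x` to strictly larger members of `A` as long as there are any; finiteness decides
  -- whether one exists and makes the climb stop.
  below-maximal : (A : DownSet Q) → ∀ {x} → x ∈ A → ∃[ m ] IsMaximal Q A m × x ≤ m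
  below-maximal A {x} = climb (>-wellFounded x)
    where
    Above : Carrier → Pred Carrier _
    Above x y = y ∈ A × x < y

    above? : ∀ x → Dec (∃[ y ] Above x y)
    above? x = ∃? Eq.setoid enumerates
      (λ y≈z (y∈A , x≤y , x≉y) →
        DownSet.downClosed A (reflexive (Eq.sym y≈z)) y∈A ,
        trans x≤y (reflexive y≈z) , λ x≈z → x≉y (Eq.trans x≈z (Eq.sym y≈z)))
      (λ y → T? _ ×-dec ((x ≤? y) ×-dec ¬? (x ≟ y)))

    climb : ∀ {x} → Acc (flip _<_) x → x ∈ A → ∃[ m ] IsMaximal Q A m × x ≤ m
    climb {x} (acc rs) x∈A with above? x
    ... | yes (y , y∈A , x<y) =
      let m , max , y≤m = climb (rs x<y) y∈A in m , max , trans (proj₁ x<y) y≤m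
    ... | no ¬above = x , (x∈A , maximal) , refl
      where
      maximal : ∀ y → y ∈ A → x ≤ y → x ≈ y
      maximal y y∈A x≤y with x ≟ y
      ... | yes x≈y = x≈y
      ... | no  x≉y = ⊥-elim (¬above (y , y∈A , x≤y , x≉y))

module _ (Q : FinitePoset c ℓ₁ ℓ₂) (R : FinitePoset d ℓ₃ ℓ₄) where
  private
    module Q = FinitePoset Q
    module R = FinitePoset R

  module _ {φ : Q.Carrier → R.Carrier} (φ-quot : IsQuotientMap Q.poset R.poset φ)
           (A : DownSet Q) where

    private
      InHat : Pred R.Carrier _
      InHat r = ∃[ a ] IsMaximal Q A a × r R.≤ φ a

    ∈-hat⁺ : ∀ r → InHat r → r ∈ hat Q R φ-quot A
    ∈-hat⁺ r = fromWitness {A = InHat r}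

    ∈-hat⁻ : ∀ r → r ∈ hat Q R φ-quot A → InHat r
    ∈-hat⁻ r = toWitness {A = InHat r}

-- Join-irreducibles and the Birkhoff isomorphism.

module FiniteDistributiveLatticeProperties
         (L : FiniteDistributiveLattice c ℓ₁ ℓ₂) where
  open FiniteDistributiveLattice L
  open JoinSemilatticeProperties joinSemilattice using (∨-cong)
  private
    module J = FinitePoset (𝓙 L)

  finitePoset : FinitePoset c ℓ₁ ℓ₂
  finitePoset = record
    { decPoset   = record { isDecPartialOrder = record
        { isPartialOrder = isPartialOrder ; _≟_ = _≟_ ; _≤?_ = _≤?_ } }
    ; elements   = elements
    ; enumerates = enumerates
    }

  open FinitePosetProperties finitePoset using (_<_; <-wellFounded)

  private
    -- An explicit failure of irreducibility. Deciding whether one exists yields actual joinands,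
    -- which a mere negation of `JoinIrreducible` would not.
    Split : Carrier → Carrier → Carrier → Set _
    Split x a b = x ≈ a ∨ b × ¬ x ≈ a × ¬ x ≈ b

    split-resp : ∀ {x a b a′ b′} → a ≈ a′ → b ≈ b′ → Split x a b → Split x a′ b′
    split-resp a≈a′ b≈b′ (e , x≉a , x≉b) =
      Eq.trans e (∨-cong a≈a′ b≈b′) ,
      (λ x≈a′ → x≉a (Eq.trans x≈a′ (Eq.sym a≈a′))) ,
      (λ x≈b′ → x≉b (Eq.trans x≈b′ (Eq.sym b≈b′)))

    split? : ∀ x → Dec (∃[ a ] ∃[ b ] Split x a b)
    split? x =
      ∃? setoid enumerates (λ a≈a′ (b , s) → b , split-resp a≈a′ Eq.refl s) λ a →
      ∃? setoid enumerates (λ b≈b′ → split-resp Eq.refl b≈b′) λ b →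
      (x ≟ (a ∨ b)) ×-dec (¬? (x ≟ a) ×-dec ¬? (x ≟ b))

  -- Well-founded induction along `<`: an element that is neither `⊥` nor irreducible splits as
  -- `a ∨ b`, and both joinands, differing from it, lie strictly below it.
  ∨-induction : (P : Pred Carrier ℓ) → P Respects _≈_ → P ⊥ →
                (∀ {x} → JoinIrreducible x → P x) →
                (∀ {x y} → P x → P y → P (x ∨ y)) → ∀ x → P x
  ∨-induction P resp P⊥ Pirr P∨ x = go x (<-wellFounded x)
    where
    go : ∀ x → Acc _<_ x → P x
    go x (acc rs) with x ≟ ⊥ | split? x
    ... | yes x≈⊥ | _ = resp (Eq.sym x≈⊥) P⊥
    ... | no  x≉⊥ | yes (a , b , x≈a∨b , x≉a , x≉b) = resp (Eq.sym x≈a∨b)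
      (P∨ (go a (rs (trans (x≤x∨y a b) a∨b≤x , λ a≈x → x≉a (Eq.sym a≈x))))
          (go b (rs (trans (y≤x∨y a b) a∨b≤x , λ b≈x → x≉b (Eq.sym b≈x)))))
      where
      a∨b≤x : a ∨ b ≤ x
      a∨b≤x = reflexive (Eq.sym x≈a∨b)
    ... | no  x≉⊥ | no ¬split = Pirr (x≉⊥ , irreducible)
      where
      irreducible : ∀ a b → x ≈ a ∨ b → x ≈ a ⊎ x ≈ b
      irreducible a b x≈a∨b with x ≟ a | x ≟ b
      ... | yes x≈a | _       = inj₁ x≈a
      ... | no  _   | yes x≈b = inj₂ x≈b
      ... | no  x≉a | no  x≉b = ⊥-elim (¬split (a , b , x≈a∨b , x≉a , x≉b))

  joinIrreducible⇒≰⊥ : ∀ {j} → JoinIrreducible j → ¬ j ≤ ⊥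
  joinIrreducible⇒≰⊥ (j≉⊥ , _) j≤⊥ = j≉⊥ (antisym j≤⊥ (minimum _))

  -- By distributivity `j` equals `(j ∧ x) ∨ (j ∧ y)`, so irreducibility makes `j` equal to one of
  -- the two meets.
  joinIrreducible⇒joinPrime : ∀ {j} → JoinIrreducible j →
                              ∀ {x y} → j ≤ x ∨ y → j ≤ x ⊎ j ≤ y
  joinIrreducible⇒joinPrime {j} (_ , irr) {x} {y} j≤x∨y = Sum.map below below
    (irr (j ∧ x) (j ∧ y)
      (Eq.trans (antisym (∧-greatest refl j≤x∨y) (x∧y≤x _ _)) (∧-distribˡ-∨ j x y)))
    where
    below : ∀ {z} → j ≈ j ∧ z → j ≤ z
    below j≈j∧z = trans (reflexive j≈j∧z) (x∧y≤y _ _)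

  ∈-birkhoff⁺ : ∀ {a} (j : J.Carrier) → proj₁ j ≤ a → j ∈ birkhoff L a
  ∈-birkhoff⁺ {a} j = fromWitness {a? = proj₁ j ≤? a}

  ∈-birkhoff⁻ : ∀ {a} (j : J.Carrier) → j ∈ birkhoff L a → proj₁ j ≤ a
  ∈-birkhoff⁻ {a} j = toWitness {a? = proj₁ j ≤? a}

  birkhoff-mono : ∀ {a b} → a ≤ b → ∀ j → j ∈ birkhoff L a → j ∈ birkhoff L b
  birkhoff-mono a≤b j j∈a = ∈-birkhoff⁺ j (trans (∈-birkhoff⁻ j j∈a) a≤b)

  birkhoff-cancel : ∀ {a b} → (∀ j → j ∈ birkhoff L a → j ∈ birkhoff L b) → a ≤ b
  birkhoff-cancel {a} {b} a⊆b = ∨-induction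
    -- The hypothesis on irreducibles sits inside the motive, because it has to be restricted to
    -- each joinand.
    (λ x → (∀ j → JoinIrreducible j → j ≤ x → j ≤ b) → x ≤ b)
    (λ x≈y f g → trans (reflexive (Eq.sym x≈y))
      (f λ j irr j≤x → g j irr (trans j≤x (reflexive x≈y))))
    (λ _ → minimum b)
    (λ irr f → f _ irr refl)
    (λ f g h → ∨-least (f λ j irr j≤x → h j irr (trans j≤x (x≤x∨y _ _)))
                       (g λ j irr j≤y → h j irr (trans j≤y (y≤x∨y _ _))))
    a (λ j irr j≤a → ∈-birkhoff⁻ (j , irr) (a⊆b (j , irr) (∈-birkhoff⁺ (j , irr) j≤a)))

  module _ (A : DownSet (𝓙 L)) where

    -- Over the full enumeration this is the inverse of `birkhoff` at `A`; the list is an argument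
    -- so that proofs can recurse on it.
    ⋁_ : List J.Carrier → Carrier
    ⋁ []       = ⊥
    ⋁ (j ∷ js) with T? (DownSet.member A j)
    ... | yes _ = proj₁ j ∨ ⋁ js
    ... | no  _ = ⋁ js

    ≤⋁ : ∀ {j} → j ∈ A → ∀ {js} → Any (j J.≈_) js → proj₁ j ≤ ⋁ js
    ≤⋁ j∈A {k ∷ js} j∈js with T? (DownSet.member A k) | j∈js
    ... | yes _   | here j≈k  = trans (reflexive j≈k) (x≤x∨y _ _)
    ... | yes _   | there j∈′ = trans (≤⋁ j∈A j∈′) (y≤x∨y _ _)
    ... | no  k∉A | here j≈k  =
      ⊥-elim (k∉A (DownSet.downClosed A (reflexive (Eq.sym j≈k)) j∈A))
    ... | no  _   | there j∈′ = ≤⋁ j∈A j∈′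

    -- Join-primality puts `j` below a single joinand, which belongs to the down-set `A`; the empty
    -- join is `⊥`, with no irreducible below it.
    ≤⋁⇒∈ : ∀ (j : J.Carrier) js → proj₁ j ≤ ⋁ js → j ∈ A
    ≤⋁⇒∈ j []       j≤ = ⊥-elim (joinIrreducible⇒≰⊥ (proj₂ j) j≤)
    ≤⋁⇒∈ j (k ∷ js) j≤ with T? (DownSet.member A k)
    ... | no  _   = ≤⋁⇒∈ j js j≤
    ... | yes k∈A with joinIrreducible⇒joinPrime (proj₂ j) j≤
    ...   | inj₁ j≤k = DownSet.downClosed A j≤k k∈A
    ...   | inj₂ j≤′ = ≤⋁⇒∈ j js j≤′

    birkhoff-⋁ : Poset._≈_ (𝓞 (𝓙 L)) (birkhoff L (⋁ J.elements)) A
    birkhoff-⋁ = (λ j j∈ → ≤⋁⇒∈ j J.elements (∈-birkhoff⁻ j j∈)) ,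
                 (λ j j∈A → ∈-birkhoff⁺ j (≤⋁ j∈A (J.enumerates j)))

  birkhoff-isOrderIsomorphism :
    let module O = Poset (𝓞 (𝓙 L)) in
    IsOrderIsomorphism _≈_ O._≈_ _≤_ O._≤_ (birkhoff L)
  birkhoff-isOrderIsomorphism = record
    { isOrderMonomorphism = record
      { isOrderHomomorphism = record { cong = cong ; mono = birkhoff-mono }
      ; injective = λ (a⊆b , b⊆a) → antisym (birkhoff-cancel a⊆b) (birkhoff-cancel b⊆a)
      ; cancel    = birkhoff-cancel
      }
    ; surjective = λ A → ⋁_ A J.elements , λ {z} z≈⋁ →
        O.Eq.trans {birkhoff L z} {birkhoff L (⋁_ A J.elements)} {A}
          (cong z≈⋁) (birkhoff-⋁ A)
    }
    where
    module O = Poset (𝓞 (𝓙 L))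
    cong : ∀ {x y} → x ≈ y → birkhoff L x O.≈ birkhoff L y
    cong x≈y = birkhoff-mono (reflexive x≈y) , birkhoff-mono (reflexive (Eq.sym x≈y))

-- Join-preserving quotient maps and join-irreducibles.

module _ (L : FiniteDistributiveLattice c ℓ₁ ℓ₂)
         (M : FiniteDistributiveLattice d ℓ₃ ℓ₄) where
  private
    module L = FiniteDistributiveLattice L
    module M = FiniteDistributiveLattice M
    module Lₚ = FiniteDistributiveLatticeProperties L
    module Mₚ = FiniteDistributiveLatticeProperties M

  -- Any preimage of `M.⊥` lies above `L.⊥`, and `p` is monotone.
  quotient-⊥ : ∀ {p} → IsQuotientMap L.poset M.poset p → p L.⊥ M.≤ M.⊥
  quotient-⊥ quot =
    let x , px≈ = IsQuotientMap.surjective quot M.⊥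
    in M.trans (IsQuotientMap.mono quot (L.minimum x)) (M.reflexive (px≈ L.Eq.refl))

  -- Induction on `a` with `r` fixed: `r` is join-prime and `p` preserves joins, so `r` follows one
  -- joinand down to an irreducible. At `⊥` the premise is absurd by `quotient-⊥`.
  joinIrreducible-lift : ∀ {p} → PreservesJoins L M p → IsQuotientMap L.poset M.poset p →
    ∀ {r} → M.JoinIrreducible r → ∀ a → r M.≤ p a →
    ∃[ x ] L.JoinIrreducible x × x L.≤ a × r M.≤ p x
  joinIrreducible-lift {p} p-∨ quot {r} irr = Lₚ.∨-induction Lifts
    (λ a≈b f r≤pb →
      let x , jx , x≤a , r≤px =
            f (M.trans r≤pb (M.reflexive (IsQuotientMap.cong quot (L.Eq.sym a≈b))))
      in x , jx , L.trans x≤a (L.reflexive a≈b) , r≤px)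
    (λ r≤p⊥ → ⊥-elim (Mₚ.joinIrreducible⇒≰⊥ irr (M.trans r≤p⊥ (quotient-⊥ quot))))
    (λ {x} jx r≤px → x , jx , L.refl , r≤px)
    step
    where
    Lifts : L.Carrier → Set _
    Lifts a = r M.≤ p a → ∃[ x ] L.JoinIrreducible x × x L.≤ a × r M.≤ p x

    step : ∀ {a b} → Lifts a → Lifts b → Lifts (a L.∨ b)
    step {a} {b} f g r≤
      with Mₚ.joinIrreducible⇒joinPrime irr (M.trans r≤ (M.reflexive (p-∨ a b)))
    ... | inj₁ r≤pa = let x , jx , x≤a , r≤px = f r≤pa
                      in x , jx , L.trans x≤a (L.x≤x∨y a b) , r≤px
    ... | inj₂ r≤pb = let x , jx , x≤b , r≤px = g r≤pb
                      in x , jx , L.trans x≤b (L.y≤x∨y a b) , r≤px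

mainTheorem18 : ∀ {c ℓ₁ ℓ₂ d ℓ₃ ℓ₄}
    (L : FiniteDistributiveLattice c ℓ₁ ℓ₂)
    (T : FiniteDistributiveLattice d ℓ₃ ℓ₄) →
    let module L = FiniteDistributiveLattice L
        module T = FiniteDistributiveLattice T
        module JL = FinitePoset (𝓙 L)
        module JT = FinitePoset (𝓙 T)
    in
    (p : L.Carrier → T.Carrier)
    (image : 𝓙ImageIs𝓙 L T p)
    (p₀-quotient : IsQuotientMap JL.poset JT.poset (restrict𝓙 L T p image)) →
    PreservesJoins L T p →
    IsQuotientMap L.poset T.poset p →
    let p̂₀ = hat (𝓙 L) (𝓙 T) p₀-quotient in
    (∀ a → Poset._≈_ (𝓞 (𝓙 T)) (birkhoff T (p a)) (p̂₀ (birkhoff L a)))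
    × IsomorphicMaps L.poset T.poset (𝓞 (𝓙 L)) (𝓞 (𝓙 T)) p p̂₀
mainTheorem18 L T p image p₀-quotient p-∨ p-quotient =
  -- With the Birkhoff isomorphisms on both sides, the condition for an isomorphism of maps is
  -- `square` again.
  square , (birkhoff L , Lₚ.birkhoff-isOrderIsomorphism) ,
           (birkhoff T , Tₚ.birkhoff-isOrderIsomorphism) , square
  where
  module T = FiniteDistributiveLattice T
  module Lₚ = FiniteDistributiveLatticeProperties L
  module Tₚ = FiniteDistributiveLatticeProperties T
  open FinitePosetProperties (𝓙 L) using (below-maximal)

  square : ∀ a → Poset._≈_ (𝓞 (𝓙 T)) (birkhoff T (p a))
                   (hat (𝓙 L) (𝓙 T) p₀-quotient (birkhoff L a))
  square a = to , from
    where
    to : ∀ r → r ∈ birkhoff T (p a) → r ∈ hat (𝓙 L) (𝓙 T) p₀-quotient (birkhoff L a)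
    to r r∈ =
      let x , jx , x≤a , r≤px = joinIrreducible-lift L T p-∨ p-quotient
            (proj₂ r) a (Tₚ.∈-birkhoff⁻ r r∈)
          -- `hat` ranges over maximal elements only, so `x` is replaced by a maximal `m` above it;
          -- monotonicity keeps `r` below `p` of it.
          m , max , x≤m = below-maximal (birkhoff L a) {x , jx} (Lₚ.∈-birkhoff⁺ (x , jx) x≤a)
      in ∈-hat⁺ (𝓙 L) (𝓙 T) p₀-quotient (birkhoff L a) r
           (m , max , T.trans r≤px (IsQuotientMap.mono p-quotient x≤m))

    from : ∀ r → r ∈ hat (𝓙 L) (𝓙 T) p₀-quotient (birkhoff L a) → r ∈ birkhoff T (p a)
    from r r∈ =
      let m , (m∈ , _) , r≤pm = ∈-hat⁻ (𝓙 L) (𝓙 T) p₀-quotient (birkhoff L a) r r∈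
      in Tₚ.∈-birkhoff⁺ r
           (T.trans r≤pm (IsQuotientMap.mono p-quotient (Lₚ.∈-birkhoff⁻ m m∈)))
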